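{- Let $\mathbf{F}$ be a Fraïssé structure in $L$ and let $\mathbf{F}^{*}$ be a Fraïssé precompact relational expansion of $\mathbf{F}$ in $L^{*}$. Assume that $\mathrm{Age}(\mathbf{F}^{*})$ consists of rigid elements and that the pair $(\mathrm{Age}(\mathbf{F}),\mathrm{Age}(\mathbf{F}^{*}))$ has the relative Ramsey property for structures. Then $\mathrm{Age}(\mathbf{F}^{*})$ admits a Fraïssé subclass with the Ramsey property and the expansion property relative to $\mathrm{Age}(\mathbf{F})$.
   Context: $\mathbb{N}=\{0,1,2,\ldots\}$ and $[k]=\{0,\ldots,k-1\}$. $L$ is a countable first-order signature and $L^{*}=L\cup\{R_i : i\in I^{*}\}$, where $I^{*}$ is countable and each $R_i$ is a relation symbol not in $L$. A Fraïssé structure is a countable (infinite), locally finite (finitely generated substructures are finite), ultrahomogeneous structure (every isomorphism between finite substructures extends to an automorphism). $\mathrm{Age}(\mathbf{F})$ is the class of finite structures that embed in $\mathbf{F}$. A Fraïssé class is a countable (up to isomorphism) class of finite structures, of arbitrarily large sizes, satisfying the hereditary, joint embedding and amalgamation properties; a Fraïssé subclass of $\mathrm{Age}(\mathbf{F}^{*})$ is a Fraïssé class in $L^{*}$ contained in $\mathrm{Age}(\mathbf{F}^{*})$. An expansion $\mathbf{F}^{*}$ of $\mathbf{F}$ in $L^{*}$ is an $L^{*}$-structure whose $L$-reduct is $\mathbf{F}$; "Fraïssé expansion" means $\mathbf{F}^{*}$ is itself a Fraïssé structure in $L^{*}$. It is precompact if every element of $\mathrm{Age}(\mathbf{F})$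 has only finitely many expansions in $\mathrm{Age}(\mathbf{F}^{*})$. Both have universe $\mathbb{N}$. A structure is rigid if its only automorphism is the identity. A class $\mathcal{K}^{*}$ of $L^{*}$-structures is an expansion in $L^{*}$ of a class $\mathcal{K}$ of $L$-structures if every element of $\mathcal{K}^{*}$ is an expansion of an element of $\mathcal{K}$ and every element of $\mathcal{K}$ has an expansion in $\mathcal{K}^{*}$. For $\mathbf{B}^{*}\in\mathcal{K}^{*}$, $\mathbf{B}$ denotes its $L$-reduct. $\binom{\mathbf{B}}{\mathbf{A}}$ is the set of substructures of $\mathbf{B}$ isomorphic to $\mathbf{A}$, and $\binom{\mathbf{B}}{\mathbf{A}}_{\mathrm{Emb}}$ is the set of embeddings of $\mathbf{A}$ into $\mathbf{B}$. For $\widetilde{\mathbf{A}}_0,\widetilde{\mathbf{A}}_1\in\binom{\mathbf{B}}{\mathbf{A}}$ with universes $\tilde A_0,\tilde A_1$, write $\widetilde{\mathbf{A}}_0\cong_{\mathbf{B}^{*}}\widetilde{\mathbf{A}}_1$ if the substructures $\mathbf{B}^{*}\upharpoonright\tilde A_0$ and $\mathbf{B}^{*}\upharpoonright\tilde A_1$ of $\mathbf{B}^{*}$ are isomorphic. For $\mathcal{K}$ a class of finite $L$-structures and $\mathcal{K}^{*}$ an expansion of $\mathcal{K}$ in $L^{*}$, the pair $(\mathcal{K},\mathcal{K}^{*})$ has the relative Ramsey property for structures if for every $k\in\mathbb{N}$, $\mathbf{A}\in\mathcal{K}$, $\mathbf{B}^{*}\in\mathcal{K}^{*}$, there exists $\mathbf{C}\in\mathcal{K}$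 such that for every coloring $c:\binom{\mathbf{C}}{\mathbf{A}}\to[k]$ there exists $b\in\binom{\mathbf{C}}{\mathbf{B}}_{\mathrm{Emb}}$ such that for all $\widetilde{\mathbf{A}}_0,\widetilde{\mathbf{A}}_1\in\binom{\mathbf{B}}{\mathbf{A}}$, $\widetilde{\mathbf{A}}_0\cong_{\mathbf{B}^{*}}\widetilde{\mathbf{A}}_1$ implies $c(b(\widetilde{\mathbf{A}}_0))=c(b(\widetilde{\mathbf{A}}_1))$. A class $\mathcal{K}^{*}$ has the expansion property relative to $\mathcal{K}$ if it is an expansion of $\mathcal{K}$ and for every $\mathbf{A}\in\mathcal{K}$ there exists $\mathbf{B}\in\mathcal{K}$ such that for all $\mathbf{A}^{*},\mathbf{B}^{*}\in\mathcal{K}^{*}$ with $L$-reducts $\mathbf{A}$ and $\mathbf{B}$ respectively, $\mathbf{A}^{*}$ embeds in $\mathbf{B}^{*}$. A class $\mathcal{C}$ of finite structures has the Ramsey property if for every $k\in\mathbb{N}$ and $\mathbf{A},\mathbf{B}\in\mathcal{C}$ there exists $\mathbf{C}\in\mathcal{C}$ such that for every $c:\binom{\mathbf{C}}{\mathbf{A}}\to[k]$ there is $\widetilde{\mathbf{B}}\in\binom{\mathbf{C}}{\mathbf{B}}$ such that $c$ takes at most one value on $\binom{\widetilde{\mathbf{B}}}{\mathbf{A}}$. -}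

module Defs where

open import Axiom.UniquenessOfIdentityProofs.WithK using (uip)
open import Data.Fin using (Fin)
open import Data.List using (List)
open import Data.List.Membership.Propositional using (_∈_)
open import Data.List.Relation.Unary.Any using (Any)
open import Data.Nat using (ℕ; _≤_)
open import Data.Product using (Σ; ∃-syntax; _×_; _,_; proj₁; proj₂)
open import Data.Sum using (_⊎_; inj₁; inj₂; [_,_])
open import Data.Vec using (Vec; []; _∷_; map)
open import Data.Vec.Relation.Unary.All as All using (All; []; _∷_)
open import Data.Vec.Relation.Unary.All.Properties using (map⁺)
open import Function.Base using (_∘_; id)
open import Function.Bundles using (_↔_; _↣_; _⇔_; Func; mk⇔; Equivalence)
open import Function.Construct.Identity using (⇔-id)
open import Function.Definitions using (Injective; StrictlySurjective)
open import Level using (0ℓ)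
open import Relation.Binary.Bundles using (Setoid)
open import Relation.Binary.PropositionalEquality
  using (_≡_; _≗_; refl; sym; trans; cong; subst; setoid)
open import Relation.Unary using (Pred; Irrelevant; _≐_)
open import Relation.Unary.Properties using (≐-refl; ≐-sym; ≐-trans)

record Symbols : Set₁ where
  field
    Symbol : Set
    arity  : Symbol → ℕ

open Symbols public

record Signature : Set₁ where
  field
    functions : Symbols
    relations : Symbols

  Fun Rel : Set
  Fun = Symbol functions
  Rel = Symbol relations

  funArity : Fun → ℕ
  funArity = arity functions

  relArity : Rel → ℕ
  relArity = arity relations

open Signature public

-- "Countable" includes finite.
Countable : Set → Set
Countable A = A ↣ ℕ

CountableSignature : Signature → Set
CountableSignature L = Countable (Fun L) × Countable (Rel L)

Finite : Set → Set
Finite A = ∃[ n ] (A ↔ Fin n)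

-- The signature L* obtained by adding new relation symbols; the union is
-- disjoint, so no new symbol belongs to L.
infixl 6 _∪_
_∪_ : Signature → Symbols → Signature
L ∪ R = record
  { functions = functions L
  ; relations = record
      { Symbol = Rel L ⊎ Symbol R
      ; arity  = [ relArity L , arity R ]
      }
  }

record Structure (L : Signature) : Set₁ where
  field
    Carrier : Set
    fun     : (f : Fun L) → Vec Carrier (funArity L f) → Carrier
    rel     : (r : Rel L) → Pred (Vec Carrier (relArity L r)) 0ℓ

open Structure public

record Embedding {L : Signature} (A B : Structure L) : Set where
  field
    to        : Carrier A → Carrier B
    injective : Injective _≡_ _≡_ to
    fun-homo  : ∀ f xs → to (fun A f xs) ≡ fun B f (map to xs)
    rel-homo  : ∀ r xs → rel A r xs ⇔ rel B r (map to xs)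

open Embedding public

record Isomorphism {L : Signature} (A B : Structure L) : Set where
  field
    embedding  : Embedding A B
    surjective : StrictlySurjective _≡_ (to embedding)

  apply : Carrier A → Carrier B
  apply = to embedding

open Isomorphism public

Rigid : {L : Signature} → Structure L → Set
Rigid A = (g : Isomorphism A A) → apply g ≗ id

-- A substructure is given by its universe: a closed subset of the carrier.
-- Irrelevance of the membership predicate makes it a genuine subset, so that
-- elements of Σ (Carrier A) universe are equal as soon as their first
-- components are.
record Substructure {L : Signature} (A : Structure L) : Set₁ where
  field
    universe   : Pred (Carrier A) 0ℓ
    irrelevant : Irrelevant universe
    closed     : ∀ f {xs} → All universe xs → universe (fun A f xs)

open Substructure public

infixl 7 _↾_
_↾_ : {L : Signature} (A : Structure L) → Substructure A → Structure L
A ↾ S = record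
  { Carrier = Σ (Carrier A) (universe S)
  ; fun     = λ f xs → fun A f (map proj₁ xs)
                     , closed S f (map⁺ (All.universal proj₂ xs))
  ; rel     = λ r xs → rel A r (map proj₁ xs)
  }

universe-≡ : {L : Signature} {A : Structure L} (S : Substructure A)
             {x y : Σ (Carrier A) (universe S)} → proj₁ x ≡ proj₁ y → x ≡ y
universe-≡ S {x , p} {_ , q} refl = cong (x ,_) (irrelevant S p q)

inclusion : {L : Signature} {A : Structure L} (S : Substructure A) →
            Embedding (A ↾ S) A
inclusion S = record
  { to        = proj₁
  ; injective = universe-≡ S
  ; fun-homo  = λ _ _ → refl
  ; rel-homo  = λ _ _ → ⇔-id _
  }

data Generated {L : Signature} (A : Structure L) (xs : List (Carrier A)) :
               Carrier A → Set where
  generator : ∀ {x} → x ∈ xs → Generated A xs x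
  apply-fun : ∀ f {ys} → All (Generated A xs) ys → Generated A xs (fun A f ys)

-- The universe of a finitely generated substructure is finite when it is
-- exhausted by a finite list (Generated A xs is not proof-irrelevant).
LocallyFinite : {L : Signature} → Structure L → Set
LocallyFinite A = ∀ xs → ∃[ ys ] (∀ {x} → Generated A xs x → x ∈ ys)

Ultrahomogeneous : {L : Signature} → Structure L → Set₁
Ultrahomogeneous A =
  (S T : Substructure A) → Finite (Carrier (A ↾ S)) → Finite (Carrier (A ↾ T)) →
  (f : Isomorphism (A ↾ S) (A ↾ T)) →
  Σ (Isomorphism A A) λ g → ∀ x → apply g (proj₁ x) ≡ proj₁ (apply f x)

record IsFraïsséStructure {L : Signature} (F : Structure L) : Set₁ where
  field
    countablyInfinite : Carrier F ↔ ℕ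
    locallyFinite     : LocallyFinite F
    ultrahomogeneous  : Ultrahomogeneous F

Class : Signature → Set₁
Class L = Pred (Structure L) 0ℓ

Age : {L : Signature} → Structure L → Structure L → Set
Age F A = Finite (Carrier A) × Embedding A F

record IsFraïsséClass {L : Signature} (K : Class L) : Set₁ where
  field
    finite : ∀ {A} → K A → Finite (Carrier A)
    countableUpToIso : Σ (ℕ → Structure L) λ e →
      ∀ {A} → K A → ∃[ n ] Isomorphism A (e n)
    arbitrarilyLarge : ∀ n → Σ (Structure L) λ A →
      K A × ∃[ m ] (n ≤ m × (Carrier A ↔ Fin m))
    hereditary : ∀ {A B} → K B → Embedding A B → K A
    jointEmbedding : ∀ {A B} → K A → K B →
      Σ (Structure L) λ C → K C × Embedding A C × Embedding B C
    amalgamation : ∀ {A B C} → K A → K B → K C →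
      (f : Embedding A B) (g : Embedding A C) →
      Σ (Structure L) λ D → K D ×
        Σ (Embedding B D) λ r → Σ (Embedding C D) λ s →
          to r ∘ to f ≗ to s ∘ to g

-- The elements of Copies B A are the substructures of B isomorphic to A; two
-- of them are equal when their universes are the same subset of B.
record Copy {L : Signature} (B A : Structure L) : Set₁ where
  field
    sub : Substructure B
    iso : Isomorphism A (B ↾ sub)

open Copy public

Copies : {L : Signature} (B A : Structure L) → Setoid _ _
Copies B A = record
  { Carrier       = Copy B A
  ; _≈_           = λ S T → universe (sub S) ≐ universe (sub T)
  ; isEquivalence = record { refl = ≐-refl ; sym = ≐-sym ; trans = ≐-trans }
  }

Coloring : {L : Signature} (k : ℕ) (B A : Structure L) → Set₁
Coloring k B A = Func (Copies B A) (setoid (Fin k))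

color : {L : Signature} {k : ℕ} {B A : Structure L} →
        Coloring k B A → Copy B A → Fin k
color = Func.to

module _ {L : Signature} {B C : Structure L} (b : Embedding B C) where

  image : Substructure B → Substructure C
  image S = record
    { universe   = Image
    ; irrelevant = irr
    ; closed     = λ f ps → let (xs , qs , eq) = preimages ps in
        fun B f xs , closed S f qs ,
        trans (fun-homo b f xs) (cong (fun C f) eq)
    }
    where
    Image : Pred (Carrier C) 0ℓ
    Image y = ∃[ x ] (universe S x × to b x ≡ y)

    irr : Irrelevant Image
    irr (x , p , e) (x′ , p′ , e′) with injective b (trans e (sym e′))
    ... | refl with irrelevant S p p′ | uip e e′
    ... | refl | refl = refl

    preimages : ∀ {n} {ys : Vec (Carrier C) n} → All Image ys →
                ∃[ xs ] (All (universe S) xs × map (to b) xs ≡ ys)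
    preimages [] = [] , [] , refl
    preimages ((x , p , refl) ∷ ps) with preimages ps
    ... | xs , qs , refl = x ∷ xs , p ∷ qs , refl

  infixr 8 _[_]
  _[_] : {A : Structure L} → Copy B A → Copy C A
  _[_] {A} S = record
    { sub = image (sub S)
    ; iso = record
      { embedding = record
        { to        = h
        ; injective = λ e → injective i
            (universe-≡ (sub S) (injective b (cong proj₁ e)))
        ; fun-homo  = λ f xs → universe-≡ (image (sub S))
            (trans (cong (to b ∘ proj₁) (fun-homo i f xs))
            (trans (fun-homo b f _)
                   (cong (fun C f) (maps xs))))
        ; rel-homo  = λ r xs → mk⇔
            (λ p → subst (rel C r) (maps xs)
              (Equivalence.to (rel-homo b r _)
                (Equivalence.to (rel-homo i r xs) p)))
            (λ p → Equivalence.from (rel-homo i r xs)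
              (Equivalence.from (rel-homo b r _)
                (subst (rel C r) (sym (maps xs)) p)))
        }
      ; surjective = λ { (_ , x , p , refl) →
          let (a , e) = surjective (iso S) (x , p) in
          a , universe-≡ (image (sub S)) (cong (to b ∘ proj₁) e) }
      }
    }
    where
    i : Embedding A (B ↾ sub S)
    i = embedding (iso S)

    h : Carrier A → Carrier (C ↾ image (sub S))
    h a = to b (proj₁ (to i a)) , proj₁ (to i a) , proj₂ (to i a) , refl

    maps : ∀ {n} (xs : Vec (Carrier A) n) →
           map (to b) (map proj₁ (map (to i) xs)) ≡ map proj₁ (map h xs)
    maps []       = refl
    maps (x ∷ xs) = cong (_ ∷_) (maps xs)

RamseyProperty : {L : Signature} → Class L → Set₁
RamseyProperty {L} K =
  (k : ℕ) (A B : Structure L) → K A → K B →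
  Σ (Structure L) λ C → K C ×
    ((c : Coloring k C A) →
     Σ (Copy C B) λ B̃ →
       (Ã₀ Ã₁ : Copy (C ↾ sub B̃) A) →
       color c (inclusion (sub B̃) [ Ã₀ ]) ≡ color c (inclusion (sub B̃) [ Ã₁ ]))

module _ {L : Signature} {R : Symbols} where

  reduct : Structure (L ∪ R) → Structure L
  reduct A* = record
    { Carrier = Carrier A*
    ; fun     = fun A*
    ; rel     = rel A* ∘ inj₁
    }

  -- Functions and universes of A* and of reduct A* agree, so they have the
  -- same closed subsets.
  lift : {A* : Structure (L ∪ R)} → Substructure (reduct A*) → Substructure A*
  lift S = record
    { universe   = universe S
    ; irrelevant = irrelevant S
    ; closed     = closed S
    }

-- The expansions of A are the structures A ⊕ E, where E interprets the new
-- relation symbols on the universe of A.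
Expansion : {L : Signature} → Symbols → Structure L → Set₁
Expansion R A = (r : Symbol R) → Pred (Vec (Carrier A) (arity R r)) 0ℓ

infixl 6 _⊕_
_⊕_ : {L : Signature} {R : Symbols} (A : Structure L) → Expansion R A →
      Structure (L ∪ R)
_⊕_ {L} {R} A E = record
  { Carrier = Carrier A
  ; fun     = fun A
  ; rel     = λ { (inj₁ r) → rel A r ; (inj₂ r) → E r }
  }

reduct-⊕ : {L : Signature} {R : Symbols} (A : Structure L)
           (E : Expansion R A) → reduct (A ⊕ E) ≡ A
reduct-⊕ A E = refl

-- Expansions have predicate-valued relations, so they are counted up to having
-- the same extension.
SameExpansion : {L : Signature} {R : Symbols} {A : Structure L}
                (E E′ : Expansion R A) → Set
SameExpansion E E′ = ∀ r → E r ≐ E′ r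

Precompact : {L : Signature} {R : Symbols} (F : Structure L) →
             Expansion R F → Set₁
Precompact {L} {R} F F⁺ =
  (A : Structure L) → Age F A →
  Σ (List (Expansion R A)) λ Es →
    (E : Expansion R A) → Age (F ⊕ F⁺) (A ⊕ E) → Any (SameExpansion {A = A} E) Es

module _ {L : Signature} {R : Symbols} where

  record IsExpansionOf (K : Class L) (K* : Class (L ∪ R)) : Set₁ where
    field
      reducts    : ∀ A* → K* A* → K (reduct A*)
      expansions : ∀ A → K A → Σ (Expansion R A) λ E → K* (A ⊕ E)

  record ExpansionProperty (K : Class L) (K* : Class (L ∪ R)) : Set₁ where
    field
      isExpansionOf : IsExpansionOf K K*
      universal     : ∀ A → K A → Σ (Structure L) λ B → K B ×
        ((E : Expansion R A) (E′ : Expansion R B) →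
         K* (A ⊕ E) → K* (B ⊕ E′) → Embedding (A ⊕ E) (B ⊕ E′))

  RelativeRamseyForStructures : (K : Class L) (K* : Class (L ∪ R)) → Set₁
  RelativeRamseyForStructures K K* =
    (k : ℕ) (A : Structure L) → K A → (B* : Structure (L ∪ R)) → K* B* →
    Σ (Structure L) λ C → K C ×
      ((c : Coloring k C A) →
       Σ (Embedding (reduct B*) C) λ b →
         (Ã₀ Ã₁ : Copy (reduct B*) A) →
         Isomorphism (B* ↾ lift (sub Ã₀)) (B* ↾ lift (sub Ã₁)) →
         color c (b [ Ã₀ ]) ≡ color c (b [ Ã₁ ]))

module Submission where

-- Put K = Age F and K₀ = Age (F ⊕ F⁺).  The required subclass K* is a minimal
-- hereditary subclass of K₀ that still expands every member of K.
--
-- Existence of K* (MinimalSubclass).  Enumerate K₀ up to isomorphism as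
-- e 0, e 1, ...  Starting from K₀, discard at stage n all structures in which
-- e n embeds, provided that what is left still expands every member of K.  The
-- intersection K* of the stages expands every member of K because, by
-- precompactness, a member of K has finitely many expansions in K₀, one of
-- which therefore survives every stage (any-∀).
--
-- Expansion property.  If A* isomorphic to e n belongs to K*, then stage n
-- discarded nothing, so some B in K has no expansion at stage n that omits A*
-- (unavoidable).  Jointly embedding such B's for the finitely many expansions
-- of A in K* gives a witness for A.  The joint embedding property passes from
-- K to K* through such witnesses.
--
-- Ramsey property (ramsey).  Given A* and B* in K*, with reduct A of A*, choose
-- D in K such that every expansion of D in K* embeds B* and all expansions of A
-- in K*.  Fix an expansion D* of D in K* and apply the relative Ramsey
-- property to A and D*, obtaining C; fix an expansion C* of C in K*.  A
-- coloring of the copies of A* in C* yields a coloring of the copies of A in C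
-- that records the isomorphism type of the expansion induced by C* and, for
-- copies of A*, the given color.  Let b : D → C be such that this refined color
-- depends only on the type in D*, and let D′ be D with the expansion induced
-- by C* through b.  Then the type in D′ is a function of the type in D*.  All
-- of the finitely many types occur in D′, so this function is a surjection of
-- a finite set onto itself, hence injective: the type in D′ determines the
-- type in D*, hence the refined color.  In particular all copies of A* in D′
-- have the same color, and B* embeds in D′.
--
-- Amalgamation (amalgamate).  To amalgamate f : A → B and g : A → C, embed B
-- and C in a common D and color the copies of A in a Ramsey witness E for D
-- according to whether they extend to a copy of B along f.  The coloring is
-- constant on some copy of D, and positive on the part coming from B, so the
-- copy of A inside the copy of C also extends to a copy of B.  The two
-- resulting embeddings of A have the same range, and agree by rigidity.
--
-- Copies of A are handled throughout as embeddings of A up to equality of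
-- ranges, and the expansion which C* induces on a copy as a pullback along the
-- embedding.  Excluded middle decides arbitrary types, so it also yields
-- witnesses of existential statements proved by contradiction.

open import Defs
open import Axiom.ExcludedMiddle using (ExcludedMiddle)
open import Data.Bool using (Bool; true; false; T)
open import Data.Bool.Properties using (T-irrelevant)
open import Data.Empty using (⊥-elim)
open import Data.Fin using (Fin; zero; suc; combine; punchOut; toℕ)
open import Data.Fin.Properties
  using (combine-injectiveˡ; combine-injectiveʳ; punchOut-injective;
         injective⇒≤; suc-injective; toℕ-injective; _≟_)
open import Data.List using (List; []; _∷_; _++_; lookup; tabulate; allFin)
open import Data.List.Membership.Propositional using (_∈_; find)
open import Data.List.Membership.Propositional.Properties
  using (∈-allFin; ∈-tabulate⁺; ∈-++⁺ˡ; ∈-++⁺ʳ)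
open import Data.List.Relation.Unary.Any as Any using (Any; here; there)
open import Data.List.Relation.Unary.Any.Properties using (lookup-index)
open import Data.Nat using (ℕ; zero; suc; _*_; _≤_; _<_; _⊔_; z≤n; s≤s)
open import Data.Nat.Binary using (ℕᵇ; 2[1+_]; 1+[2_]; fromℕ)
  renaming (zero to zeroᵇ; toℕ to toℕᵇ)
open import Data.Nat.Binary.Properties using (fromℕ-toℕ)
open import Data.Nat.Properties
  using (<-≤-trans; <-irrefl; m≤n⇒m<n∨m≡n; m≤m⊔n; m≤n⊔m)
open import Data.Product using (Σ; ∃-syntax; _×_; _,_; proj₁; proj₂)
open import Data.Sum using (inj₁; inj₂)
open import Data.Unit using (⊤; tt)
open import Data.Vec using (Vec; map)
open import Data.Vec.Properties using (map-∘; map-id; map-cong)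
open import Data.Vec.Relation.Unary.All as All using ()
open import Function.Base using (_∘_; id; case_of_)
open import Function.Bundles
  using (_↔_; _⇔_; mk⇔; mk↔ₛ′; Equivalence; Inverse; Func)
open import Function.Construct.Identity using (⇔-id)
open import Function.Construct.Symmetry using (↔-sym)
open import Function.Definitions using (Injective)
open import Level using (0ℓ)
open import Relation.Binary.PropositionalEquality
  using (_≡_; _≢_; _≗_; refl; sym; trans; cong; subst)
open import Relation.Nullary using (¬_; Dec; yes; no; does)
open import Relation.Nullary.Decidable
  using (True; toWitness; fromWitness; decidable-stable; dec-true; dec-false)
open import Relation.Unary using (Pred; _⊆_; _≐_)
open import Relation.Unary.Properties using (≐-sym; ≐-trans)

-- Embeddings and their ranges

module _ {L : Signature} where

  idₑ : {A : Structure L} → Embedding A A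
  idₑ {A} = record
    { to        = id
    ; injective = id
    ; fun-homo  = λ f xs → cong (fun A f) (sym (map-id xs))
    ; rel-homo  = λ r xs →
        subst (λ ys → rel A r xs ⇔ rel A r ys) (sym (map-id xs)) (⇔-id _)
    }

  infixr 9 _∘ₑ_
  _∘ₑ_ : {A B C : Structure L} → Embedding B C → Embedding A B → Embedding A C
  _∘ₑ_ {A} {B} {C} g f = record
    { to        = to g ∘ to f
    ; injective = injective f ∘ injective g
    ; fun-homo  = λ h xs → trans (cong (to g) (fun-homo f h xs))
        (trans (fun-homo g h _) (cong (fun C h) (sym (map-∘ (to g) (to f) xs))))
    ; rel-homo  = λ r xs → subst (λ ys → rel A r xs ⇔ rel C r ys)
        (sym (map-∘ (to g) (to f) xs))
        (mk⇔ (Equivalence.to (rel-homo g r _) ∘ Equivalence.to (rel-homo f r xs))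
             (Equivalence.from (rel-homo f r xs) ∘
              Equivalence.from (rel-homo g r _)))
    }

  Range : {A B : Structure L} → Embedding A B → Pred (Carrier B) 0ℓ
  Range f y = ∃[ x ] to f x ≡ y

  factor : {A B C : Structure L} (f : Embedding A C) (g : Embedding B C) →
           Range f ⊆ Range g → Σ (Embedding A B) λ h → to g ∘ to h ≗ to f
  factor {A} {B} {C} f g f⊆g = record
    { to        = h
    ; injective = λ {x} {y} e →
        injective f (trans (sym (gh x)) (trans (cong (to g) e) (gh y)))
    ; fun-homo  = λ s xs → injective g
        (trans (gh _) (trans (fun-homo f s xs)
          (trans (cong (fun C s) (maps xs)) (sym (fun-homo g s _)))))
    ; rel-homo  = λ r xs → mk⇔
        (λ p → Equivalence.from (rel-homo g r _)
          (subst (rel C r) (maps xs) (Equivalence.to (rel-homo f r xs) p)))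
        (λ p → Equivalence.from (rel-homo f r xs)
          (subst (rel C r) (sym (maps xs)) (Equivalence.to (rel-homo g r _) p)))
    } , gh
    where
    h : Carrier A → Carrier B
    h x = proj₁ (f⊆g (x , refl))

    gh : to g ∘ h ≗ to f
    gh x = proj₂ (f⊆g (x , refl))

    maps : ∀ {n} (xs : Vec (Carrier A) n) →
           map (to f) xs ≡ map (to g) (map h xs)
    maps xs = trans (map-cong (sym ∘ gh) xs) (map-∘ (to g) h xs)

  -- The workhorse for comparing embeddings: an embedding is determined up to an
  -- isomorphism of its domain by its range.
  range-iso : {A B C : Structure L} (f : Embedding A C) (g : Embedding B C) →
              Range f ≐ Range g → Σ (Isomorphism A B) λ h → to g ∘ apply h ≗ to f
  range-iso f g (f⊆g , g⊆f) = let (h , gh) = factor f g f⊆g in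
    record { embedding  = h
           ; surjective = λ y → let (x , e) = g⊆f (y , refl) in
               x , injective g (trans (gh x) e) } , gh

  iso-sym : {A B : Structure L} → Isomorphism A B → Isomorphism B A
  iso-sym f = proj₁ (range-iso idₑ (embedding f)
    ((λ { (y , refl) → surjective f y }) , λ _ → _ , refl))

  iso-refl : {A : Structure L} → Isomorphism A A
  iso-refl = record { embedding = idₑ ; surjective = λ y → y , refl }

  iso-trans : {A B C : Structure L} →
              Isomorphism A B → Isomorphism B C → Isomorphism A C
  iso-trans f g = record
    { embedding  = embedding g ∘ₑ embedding f
    ; surjective = λ z → let (y , e) = surjective g z
                             (x , e′) = surjective f y in
        x , trans (cong (apply g) e′) e
    }

  -- A as a copy of itself.
  self : {A : Structure L} → Copy A A
  self {A} = record
    { sub = whole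
    ; iso = proj₁ (range-iso idₑ (inclusion whole)
              ((λ _ → (_ , tt) , refl) , λ _ → _ , refl))
    }
    where
    whole : Substructure A
    whole = record
      { universe   = λ _ → ⊤
      ; irrelevant = λ _ _ → refl
      ; closed     = λ _ _ → tt
      }

  rangeCopy : {A B : Structure L} → Embedding A B → Copy B A
  rangeCopy f = f [ self ]

  range≐universe : {A B : Structure L} (f : Embedding A B) →
                   Range f ≐ universe (sub (rangeCopy f))
  range≐universe f = (λ (x , e) → x , tt , e) , λ (x , _ , e) → x , e

  copyEmbedding : {A B : Structure L} → Copy B A → Embedding A B
  copyEmbedding S = inclusion (sub S) ∘ₑ embedding (iso S)

  universe≐range : {A B : Structure L} (S : Copy B A) →
                   universe (sub S) ≐ Range (copyEmbedding S)
  universe≐range S =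
      (λ {y} p → let (x , e) = surjective (iso S) (y , p) in x , cong proj₁ e)
    , λ { (x , refl) → proj₂ (apply (iso S) x) }

  -- Colorings of the copies of A in C are the colorings of the embeddings of A
  -- in C that depend only on the range.
  RangeInvariant : {A C : Structure L} {X : Set} → (Embedding A C → X) → Set
  RangeInvariant {A} {C} c =
    (a₀ a₁ : Embedding A C) → Range a₀ ≐ Range a₁ → c a₀ ≡ c a₁

  -- The Ramsey property for copies, expressed through embeddings.
  EmbeddingRamsey : Class L → Set₁
  EmbeddingRamsey K =
    (k : ℕ) (A B : Structure L) → K A → K B →
    Σ (Structure L) λ C → K C ×
      ((c : Embedding A C → Fin k) → RangeInvariant c →
       Σ (Embedding B C) λ b →
         (a₀ a₁ : Embedding A B) → c (b ∘ₑ a₀) ≡ c (b ∘ₑ a₁))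

  embeddingRamsey⇒ramsey : {K : Class L} → EmbeddingRamsey K → RamseyProperty K
  embeddingRamsey⇒ramsey ramsey k A B kA kB =
    let (C , kC , arrow) = ramsey k A B kA kB in
    C , kC , λ c →
      let (b , mono) = arrow (λ a → color c (rangeCopy a))
            (λ a₀ a₁ e → Func.cong c
              (≐-trans (≐-sym (range≐universe a₀))
                       (≐-trans e (range≐universe a₁))))
          B̃ : Copy C B
          B̃ = rangeCopy b
          -- A copy of A inside the range of b, pulled back to B.
          a : (Ã : Copy (C ↾ sub B̃) A) → Σ (Embedding A B) λ a →
              to b ∘ to a ≗ proj₁ ∘ to (copyEmbedding Ã)
          a Ã = factor (inclusion (sub B̃) ∘ₑ copyEmbedding Ã) b
            λ { (x , refl) →
              proj₂ (range≐universe b) (proj₂ (to (copyEmbedding Ã) x)) }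
          agree : (Ã : Copy (C ↾ sub B̃) A) →
                  universe (sub (rangeCopy (b ∘ₑ proj₁ (a Ã))))
                  ≐ universe (sub (inclusion (sub B̃) [ Ã ]))
          agree Ã = let ba = proj₂ (a Ã) in
              (λ { (x , _ , refl) →
                 _ , proj₂ (universe≐range Ã) (x , refl) , sym (ba x) })
            , λ { (z , p , refl) → let (x , e) = proj₁ (universe≐range Ã) p in
                 x , tt , trans (ba x) (cong proj₁ e) }
      in B̃ , λ Ã₀ Ã₁ →
        trans (sym (Func.cong c (agree Ã₀)))
          (trans (mono (proj₁ (a Ã₀)) (proj₁ (a Ã₁))) (Func.cong c (agree Ã₁)))

-- Classes of structures and expansions

Hereditary : {L : Signature} → Class L → Set₁
Hereditary K = ∀ {A B} → K B → Embedding A B → K A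

JointEmbedding : {L : Signature} → Class L → Set₁
JointEmbedding {L} K = ∀ {A B} → K A → K B →
  Σ (Structure L) λ C → K C × Embedding A C × Embedding B C

module _ {L : Signature} {R : Symbols} where

  reductₑ : {A* B* : Structure (L ∪ R)} →
            Embedding A* B* → Embedding (reduct A*) (reduct B*)
  reductₑ f = record
    { to        = to f
    ; injective = injective f
    ; fun-homo  = fun-homo f
    ; rel-homo  = λ r → rel-homo f (inj₁ r)
    }

  -- The expansion of A induced by B* along an embedding of A in its reduct.
  pullback : {A : Structure L} (B* : Structure (L ∪ R)) →
             Embedding A (reduct B*) → Expansion R A
  pullback B* f r xs = rel B* (inj₂ r) (map (to f) xs)

  pullbackₑ : {A : Structure L} (B* : Structure (L ∪ R))
              (f : Embedding A (reduct B*)) → Embedding (A ⊕ pullback B* f) B*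
  pullbackₑ B* f = record
    { to        = to f
    ; injective = injective f
    ; fun-homo  = fun-homo f
    ; rel-homo  = λ { (inj₁ r) xs → rel-homo f r xs ; (inj₂ r) xs → ⇔-id _ }
    }

  pullback-range : {A₀ A₁ : Structure L} (B* : Structure (L ∪ R))
    (a₀ : Embedding A₀ (reduct B*)) (a₁ : Embedding A₁ (reduct B*)) →
    Range a₀ ≐ Range a₁ → Isomorphism (A₀ ⊕ pullback B* a₀) (A₁ ⊕ pullback B* a₁)
  pullback-range B* a₀ a₁ e =
    proj₁ (range-iso (pullbackₑ B* a₀) (pullbackₑ B* a₁) e)

  sameExpansion⇒iso : {A : Structure L} {E E′ : Expansion R A} →
    SameExpansion {A = A} E E′ → Isomorphism (A ⊕ E) (A ⊕ E′)
  sameExpansion⇒iso {A} {E} {E′} e = record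
    { embedding  = record
      { to        = id
      ; injective = id
      ; fun-homo  = fun-homo idₐ
      ; rel-homo  = λ { (inj₁ r) xs → rel-homo idₐ r xs
                      ; (inj₂ r) xs → subst (λ ys → E r xs ⇔ E′ r ys)
                          (sym (map-id xs)) (mk⇔ (proj₁ (e r)) (proj₂ (e r))) }
      }
    ; surjective = λ y → y , refl
    }
    where
    idₐ : Embedding A A
    idₐ = idₑ

  -- The relative Ramsey property expressed through embeddings: the type of a
  -- copy of A in B* is the expansion of A pulled back along the embedding.
  relativeRamsey-embeddings :
    {K : Class L} {K* : Class (L ∪ R)} → RelativeRamseyForStructures K K* →
    (k : ℕ) (A : Structure L) → K A → (B* : Structure (L ∪ R)) → K* B* →
    Σ (Structure L) λ C → K C ×
      ((c : Embedding A C → Fin k) → RangeInvariant c →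
       Σ (Embedding (reduct B*) C) λ b →
         (a₀ a₁ : Embedding A (reduct B*)) →
         Isomorphism (A ⊕ pullback B* a₀) (A ⊕ pullback B* a₁) →
         c (b ∘ₑ a₀) ≡ c (b ∘ₑ a₁))
  relativeRamsey-embeddings ramsey k A kA B* kB* =
    let (C , kC , arrow) = ramsey k A kA B* kB* in
    C , kC , λ c c-inv →
      let (b , mono) = arrow record
            { to   = λ S → c (copyEmbedding S)
            ; cong = λ {S} {T} e → c-inv _ _
                (≐-trans (≐-sym (universe≐range S))
                         (≐-trans e (universe≐range T)))
            }
          restrict : (a : Embedding A (reduct B*)) →
            Isomorphism (A ⊕ pullback B* a) (B* ↾ lift (sub (rangeCopy a)))
          restrict a = proj₁ (range-iso (pullbackₑ B* a)
            (inclusion (lift (sub (rangeCopy a))))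
            ( (λ { (x , refl) → (_ , x , tt , refl) , refl })
            , λ { ((_ , x , _ , refl) , refl) → x , refl }))
      in b , λ a₀ a₁ i →
        trans (c-inv _ _ (id , id))
          (trans (mono (rangeCopy a₀) (rangeCopy a₁)
                   (iso-trans (iso-sym (restrict a₀))
                              (iso-trans i (restrict a₁))))
                 (c-inv _ _ (id , id)))

  -- A finite transversal of the isomorphism types of the expansions of A in K*.
  record IsoTypes (K* : Class (L ∪ R)) (A : Structure L) : Set₁ where
    field
      number     : ℕ
      type       : Fin number → Expansion R A
      inClass    : ∀ i → K* (A ⊕ type i)
      distinct   : ∀ i j → Isomorphism (A ⊕ type i) (A ⊕ type j) → i ≡ j
      exhaustive : ∀ E → K* (A ⊕ E) → ∃[ i ] Isomorphism (A ⊕ type i) (A ⊕ E)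

  -- The relation between A and D required by the expansion property.
  Absorbs : Class (L ∪ R) → Structure L → Structure L → Set₁
  Absorbs K* A D = (E : Expansion R A) (E′ : Expansion R D) →
    K* (A ⊕ E) → K* (D ⊕ E′) → Embedding (A ⊕ E) (D ⊕ E′)

  absorbs-mono : {K* : Class (L ∪ R)} → Hereditary K* →
                 {A D D′ : Structure L} → Absorbs K* A D → Embedding D D′ →
                 Absorbs K* A D′
  absorbs-mono her {D′ = D′} absorbs f E E′ kA kD =
    let i = pullbackₑ (D′ ⊕ E′) f in
    i ∘ₑ absorbs E _ kA (her kD i)

  newRelations : (A* : Structure (L ∪ R)) → Expansion R (reduct A*)
  newRelations A* r = rel A* (inj₂ r)

  -- A* and the expansion of its reduct by its own new relations interpret the
  -- symbols alike, but are not equal by definition: the relations of an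
  -- expansion are defined by cases on the symbol.
  splitting : (A* : Structure (L ∪ R)) →
              Isomorphism (reduct A* ⊕ newRelations A*) A*
  splitting A* = record
    { embedding = record
      { to        = id
      ; injective = id
      ; fun-homo  = fun-homo idₐ
      ; rel-homo  = λ { (inj₁ r) → rel-homo idₐ (inj₁ r)
                      ; (inj₂ r) → rel-homo idₐ (inj₂ r) }
      }
    ; surjective = λ y → y , refl
    }
    where
    idₐ : Embedding A* A*
    idₐ = idₑ

-- Finite combinatorics

↔-injective : {X Y : Set} (f : X ↔ Y) → Injective _≡_ _≡_ (Inverse.to f)
↔-injective f e = trans (sym (Inverse.strictlyInverseʳ f _))
  (trans (cong (Inverse.from f) e) (Inverse.strictlyInverseʳ f _))

surjective⇒injective : ∀ {n} (f : Fin n → Fin n) → (∀ j → ∃[ i ] f i ≡ j) →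
                       Injective _≡_ _≡_ f
surjective⇒injective {zero} f f-surj {()}
surjective⇒injective {suc n} f f-surj {i} {j} fi≡fj with i ≟ j
... | yes i≡j = i≡j
... | no i≢j = ⊥-elim (collapse (g (f i) ≟ i))
  where
  -- A section g of f is injective, hence onto; but g hits at most one point of
  -- each fibre, so it misses i or j.
  g : Fin (suc n) → Fin (suc n)
  g = proj₁ ∘ f-surj

  g-inj : Injective _≡_ _≡_ g
  g-inj {x} {y} e =
    trans (sym (proj₂ (f-surj x))) (trans (cong f e) (proj₂ (f-surj y)))

  unmissed : ∀ k → ¬ (∀ y → k ≢ g y)
  unmissed k missed = <-irrefl refl
    (injective⇒≤ {f = λ y → punchOut (missed y)}
      (λ e → g-inj (punchOut-injective (missed _) (missed _) e)))

  retract : ∀ k → f k ≡ f i → ∀ y → k ≡ g y → g (f i) ≡ k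
  retract k fk≡fi y k≡gy = trans (cong g (trans (sym fk≡fi)
    (trans (cong f k≡gy) (proj₂ (f-surj y))))) (sym k≡gy)

  collapse : ¬ Dec (g (f i) ≡ i)
  collapse (yes p) = unmissed j λ y e →
    i≢j (trans (sym p) (retract j (sym fi≡fj) y e))
  collapse (no ¬p) = unmissed i λ y e → ¬p (retract i refl y e)

-- Consequences of the expansion property

module Classical (em : ∀ {ℓ} → ExcludedMiddle ℓ) where

  module _ {L : Signature} {R : Symbols} {K : Class L} {K* : Class (L ∪ R)}
    (her : Hereditary K*) (jep : JointEmbedding K) (ep : ExpansionProperty K K*)
    where

    open ExpansionProperty ep
    open IsExpansionOf isExpansionOf

    private
      restrict : {A : Structure L} (B* : Structure (L ∪ R)) →
                 K* B* → (a : Embedding A (reduct B*)) → K* (A ⊕ pullback B* a)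
      restrict B* kB* a = her kB* (pullbackₑ B* a)

      absorbed : (A* : Structure (L ∪ R)) {D₀ D : Structure L} →
        Absorbs K* (reduct A*) D₀ → Embedding D₀ D →
        (E : Expansion R D) → K* A* → K* (D ⊕ E) → Embedding A* (D ⊕ E)
      absorbed A* abs i E kA kE =
        absorbs-mono {K* = K*} her abs i _ E
            (her kA (embedding (splitting A*))) kE
          ∘ₑ embedding (iso-sym (splitting A*))

    expansionProperty⇒jointEmbedding : JointEmbedding K*
    expansionProperty⇒jointEmbedding {A*} {B*} kA kB =
      let (D₀ , kD₀ , abs₀) = universal _ (reducts A* kA)
          (D₁ , kD₁ , abs₁) = universal _ (reducts B* kB)
          (D , kD , i₀ , i₁) = jep kD₀ kD₁
          (E , kE) = expansions D kD
      in D ⊕ E , kE , absorbed A* abs₀ i₀ E kA kE , absorbed B* abs₁ i₁ E kB kE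

    module _ (types : ∀ A → K A → IsoTypes K* A)
             (relativeRamsey : RelativeRamseyForStructures K K*) where

      -- The coloring argument: E expands D, E′ expands C, and c colors the
      -- embeddings of A* in C ⊕ E′.
      module Refinement {k : ℕ} {A* : Structure (L ∪ R)} (kA* : K* A*)
               {D : Structure L} (E : Expansion R D) (kE : K* (D ⊕ E))
               (absA : Absorbs K* (reduct A*) D)
               {C : Structure L} (E′ : Expansion R C) (kE′ : K* (C ⊕ E′))
               (c : Embedding A* (C ⊕ E′) → Fin k) (c-inv : RangeInvariant c)
               where

        private
          A : Structure L
          A = reduct A*

          D* C* : Structure (L ∪ R)
          D* = D ⊕ E
          C* = C ⊕ E′

        open IsoTypes (types A (reducts A* kA*))

        -- The type of the copy of A given by a in B*.
        typeIn : (B* : Structure (L ∪ R)) → K* B* →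
                 (a : Embedding A (reduct B*)) →
                 ∃[ i ] Isomorphism (A ⊕ type i) (A ⊕ pullback B* a)
        typeIn B* kB* a = exhaustive _ (restrict B* kB* a)

        typeC : Embedding A C → Fin number
        typeC a = proj₁ (typeIn C* kE′ a)

        typeC-unique : ∀ a i →
          Isomorphism (A ⊕ type i) (A ⊕ pullback C* a) → typeC a ≡ i
        typeC-unique a i f = distinct _ _
          (iso-trans (proj₂ (typeIn C* kE′ a)) (iso-sym f))

        -- The copy of A given by a carries a copy of A* in C*.  The embedding
        -- need not be a itself, only have the same range.
        Lift : Embedding A C → Set
        Lift a = Σ (Embedding A* C*) λ a* → Range a* ≐ Range a

        -- Color zero is reserved for the copies that do not carry A*.
        shade : (a : Embedding A C) → Dec (Lift a) → Fin (suc k)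
        shade a (yes (a* , _)) = suc (c a*)
        shade a (no _)         = zero

        shade-lift : ∀ a (d : Dec (Lift a)) a* → Range a* ≐ Range a →
                     shade a d ≡ suc (c a*)
        shade-lift a (yes (_ , e′)) a* e =
          cong suc (c-inv _ _ (≐-trans e′ (≐-sym e)))
        shade-lift a (no ¬l) a* e = ⊥-elim (¬l (a* , e))

        shade-inv : ∀ a₀ a₁ → Range a₀ ≐ Range a₁ →
          (d₀ : Dec (Lift a₀)) (d₁ : Dec (Lift a₁)) → shade a₀ d₀ ≡ shade a₁ d₁
        shade-inv a₀ a₁ e (yes (a* , e*)) d₁ =
          sym (shade-lift a₁ d₁ a* (≐-trans e* e))
        shade-inv a₀ a₁ e (no ¬l) (yes (a* , e*)) =
          ⊥-elim (¬l (a* , ≐-trans e* (≐-sym e)))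
        shade-inv a₀ a₁ e (no _) (no _) = refl

        -- The type in C* together with the given color.
        refined : Embedding A C → Fin (number * suc k)
        refined a = combine (typeC a) (shade a em)

        refined-inv : RangeInvariant refined
        refined-inv a₀ a₁ e = trans
          (cong (λ i → combine i (shade a₀ em))
            (typeC-unique a₀ _ (iso-trans (proj₂ (typeIn C* kE′ a₁))
                                  (pullback-range C* a₁ a₀ (≐-sym e)))))
          (cong (combine (typeC a₁)) (shade-inv a₀ a₁ e em em))

        module _ (b : Embedding D C)
          (mono : (a₀ a₁ : Embedding A D) →
                  Isomorphism (A ⊕ pullback D* a₀) (A ⊕ pullback D* a₁) →
                  refined (b ∘ₑ a₀) ≡ refined (b ∘ₑ a₁)) where

          -- D with the expansion induced by C* through b.
          D′ : Structure (L ∪ R)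
          D′ = D ⊕ pullback C* b

          kD′ : K* D′
          kD′ = restrict C* kE′ b

          -- Every type occurs in D*.
          sample : ∀ i → Embedding (A ⊕ type i) D*
          sample i = absA (type i) E (inClass i) kE

          -- The type in D′ as a function of the type in D*.
          transfer : Fin number → Fin number
          transfer i = typeC (b ∘ₑ reductₑ (sample i))

          -- By mono, copies of the same type in D* have images of the same type
          -- in C*, so that the choice of samples is immaterial.
          transfer-type : ∀ (a : Embedding A D) →
            transfer (proj₁ (typeIn D* kE a)) ≡ typeC (b ∘ₑ a)
          transfer-type a = let (i , f) = typeIn D* kE a in
            combine-injectiveˡ _ _ _ _ (mono (reductₑ (sample i)) a
              (iso-trans (iso-sym (proj₁ (range-iso (sample i)
                           (pullbackₑ D* (reductₑ (sample i))) (id , id)))) f))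

          transfer-surjective : ∀ j → ∃[ i ] transfer i ≡ j
          transfer-surjective j =
            let s = absA (type j) (pullback C* b) (inClass j) kD′
                a : Embedding A D
                a = reductₑ s
            in _ , trans (transfer-type a) (typeC-unique (b ∘ₑ a) j
                 (proj₁ (range-iso (pullbackₑ C* b ∘ₑ s)
                                   (pullbackₑ C* (b ∘ₑ a)) (id , id))))

          monochromatic : (a₀ a₁ : Embedding A* D′) →
            c (pullbackₑ C* b ∘ₑ a₀) ≡ c (pullbackₑ C* b ∘ₑ a₁)
          monochromatic a₀ a₁ = suc-injective
            (trans (sym (shaded a₀))
            (trans (combine-injectiveʳ
                      (typeC (b ∘ₑ down a₀)) _ (typeC (b ∘ₑ down a₁)) _
                      (mono (down a₀) (down a₁) sameTypeInD))
                   (shaded a₁)))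
            where
            down : Embedding A* D′ → Embedding A D
            down = reductₑ

            shaded : ∀ a → shade (b ∘ₑ down a) em ≡ suc (c (pullbackₑ C* b ∘ₑ a))
            shaded a =
              shade-lift (b ∘ₑ down a) em (pullbackₑ C* b ∘ₑ a) (id , id)

            expands : ∀ a → Isomorphism A* (A ⊕ pullback C* (b ∘ₑ down a))
            expands a = proj₁ (range-iso (pullbackₑ C* b ∘ₑ a)
                                 (pullbackₑ C* (b ∘ₑ down a)) (id , id))

            sameTypeInC : typeC (b ∘ₑ down a₀) ≡ typeC (b ∘ₑ down a₁)
            sameTypeInC = typeC-unique (b ∘ₑ down a₀) _
              (iso-trans (proj₂ (typeIn C* kE′ (b ∘ₑ down a₁)))
                (iso-trans (iso-sym (expands a₁)) (expands a₀)))

            sameTypeInD : Isomorphism (A ⊕ pullback D* (down a₀))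
                                      (A ⊕ pullback D* (down a₁))
            sameTypeInD =
              let (i₀ , f₀) = typeIn D* kE (down a₀)
                  (i₁ , f₁) = typeIn D* kE (down a₁)
                  i₀≡i₁ = surjective⇒injective transfer transfer-surjective
                    (trans (transfer-type (down a₀))
                      (trans sameTypeInC (sym (transfer-type (down a₁)))))
              in iso-trans (iso-sym f₀)
                   (subst (λ i → Isomorphism (A ⊕ type i)
                                             (A ⊕ pullback D* (down a₁)))
                          (sym i₀≡i₁) f₁)

      ramsey : EmbeddingRamsey K*
      ramsey k A* B* kA* kB* =
        let A = reduct A*
            kA = reducts A* kA*
            (D₀ , kD₀ , abs₀) = universal A kA
            (D₁ , kD₁ , abs₁) = universal (reduct B*) (reducts B* kB*)
            (D , kD , i₀ , i₁) = jep kD₀ kD₁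
            (E , kE) = expansions D kD
            absA = absorbs-mono {K* = K*} her abs₀ i₀
            colors = IsoTypes.number (types A kA) * suc k
            (C , kC , arrow) = relativeRamsey-embeddings {K = K} {K* = K*}
                                 relativeRamsey colors A kA (D ⊕ E) kE
            (E′ , kE′) = expansions C kC
            open Refinement kA* E kE absA E′ kE′
        in C ⊕ E′ , kE′ , λ c c-inv →
          let (b , mono) = arrow (refined c c-inv)
                                 (refined-inv c c-inv)
              E″ = pullback (C ⊕ E′) b
              γ = absorbed B* abs₁ i₁ E″ kB* (restrict (C ⊕ E′) kE′ b)
          in pullbackₑ (C ⊕ E′) b ∘ₑ γ , λ a₀ a₁ →
            trans (c-inv _ _ (id , id))
              (trans
                (monochromatic c c-inv b mono (γ ∘ₑ a₀) (γ ∘ₑ a₁))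
                (c-inv _ _ (id , id)))

  -- Amalgamation for rigid structures, by coloring a copy of A according to
  -- whether it extends to a copy of B along f.
  amalgamate : {L : Signature} {K : Class L} → JointEmbedding K →
    EmbeddingRamsey K → (∀ A → K A → Rigid A) →
    ∀ {A B C} → K A → K B → K C → (f : Embedding A B) (g : Embedding A C) →
    Σ (Structure L) λ D → K D × Σ (Embedding B D) λ r →
      Σ (Embedding C D) λ s → to r ∘ to f ≗ to s ∘ to g
  amalgamate {L} jep ramsey rigid {A} {B} {C} kA kB kC f g =
    let (D , kD , i , j) = jep kB kC
        (E , kE , arrow) = ramsey 2 A D kA kD
        (b , mono) = arrow (λ a → shade a em)
          (λ a₀ a₁ e → shade-inv a₀ a₁ e em em)
        s = b ∘ₑ j
        (r , e) = extendible (s ∘ₑ g) em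
          (trans (shade-inv (s ∘ₑ g) (b ∘ₑ (j ∘ₑ g)) (id , id) em em)
          (trans (mono (j ∘ₑ g) (i ∘ₑ f))
                 (shade-one (b ∘ₑ (i ∘ₑ f)) em (b ∘ₑ i , id , id))))
        (h , sgh≗rf) = range-iso (r ∘ₑ f) (s ∘ₑ g) e
    in E , kE , r , s , λ x →
       trans (sym (sgh≗rf x)) (cong (to s ∘ to g) (rigid A kA h x))
    where
    Extends : {E : Structure L} → Embedding A E → Set
    Extends {E} a = Σ (Embedding B E) λ r → Range (r ∘ₑ f) ≐ Range a

    shade : {E : Structure L} (a : Embedding A E) → Dec (Extends a) → Fin 2
    shade a (yes _) = suc zero
    shade a (no _)  = zero

    shade-one : {E : Structure L} (a : Embedding A E) (d : Dec (Extends a)) →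
                Extends a → shade a d ≡ suc zero
    shade-one a (yes _) x = refl
    shade-one a (no ¬x) x = ⊥-elim (¬x x)

    extendible : {E : Structure L} (a : Embedding A E) (d : Dec (Extends a)) →
                 shade a d ≡ suc zero → Extends a
    extendible a (yes x) _ = x

    shade-inv : {E : Structure L} (a₀ a₁ : Embedding A E) → Range a₀ ≐ Range a₁ →
      (d₀ : Dec (Extends a₀)) (d₁ : Dec (Extends a₁)) → shade a₀ d₀ ≡ shade a₁ d₁
    shade-inv a₀ a₁ e (yes (r , e′)) d₁ =
      sym (shade-one a₁ d₁ (r , ≐-trans e′ e))
    shade-inv a₀ a₁ e (no ¬x) (yes (r , e′)) =
      ⊥-elim (¬x (r , ≐-trans e′ (≐-sym e)))
    shade-inv a₀ a₁ e (no _) (no _) = refl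

  -- Finiteness by classical choice

  -- Pairwise unrelated representatives of the members of a list that satisfy
  -- P.
  transversal : ∀ {a p ℓ} {X : Set a} (P : X → Set p) (_≈_ : X → X → Set ℓ) →
    (∀ {x y} → x ≈ y → y ≈ x) → (∀ {x} → x ≈ x) → (xs : List X) →
    ∃[ n ] Σ (Fin n → X) λ t → (∀ i → P (t i)) ×
      (∀ i j → t i ≈ t j → i ≡ j) × (∀ {x} → x ∈ xs → P x → ∃[ i ] t i ≈ x)
  transversal P _≈_ ≈-sym ≈-refl [] = 0 , (λ ()) , (λ ()) , (λ ()) , λ ()
  transversal {X = X} P _≈_ ≈-sym ≈-refl (x ∷ xs)
    with transversal P _≈_ ≈-sym ≈-refl xs
  ... | n , t , tP , t-inj , t-exh with em {P = P x × ¬ (∃[ i ] t i ≈ x)}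
  ... | yes (px , new) = suc n , t′ , t′P , t′-inj , t′-exh
    where
    t′ : Fin (suc n) → X
    t′ zero    = x
    t′ (suc i) = t i

    t′P : ∀ i → P (t′ i)
    t′P zero    = px
    t′P (suc i) = tP i

    t′-inj : ∀ i j → t′ i ≈ t′ j → i ≡ j
    t′-inj zero    zero    e = refl
    t′-inj zero    (suc j) e = ⊥-elim (new (j , ≈-sym e))
    t′-inj (suc i) zero    e = ⊥-elim (new (i , e))
    t′-inj (suc i) (suc j) e = cong suc (t-inj i j e)

    t′-exh : ∀ {y} → y ∈ x ∷ xs → P y → ∃[ i ] t′ i ≈ y
    t′-exh (here refl) py = zero , ≈-refl
    t′-exh (there y∈)  py = let (i , e) = t-exh y∈ py in suc i , e
  ... | no old = n , t , tP , t-inj , λ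
    { (here refl) py → decidable-stable em (λ new → old (py , new))
    ; (there y∈)  py → t-exh y∈ py }

  injection⇒finite : ∀ {n} {X : Set} (f : X → Fin n) → Injective _≡_ _≡_ f →
                     Finite X
  injection⇒finite {n} {X} f f-inj =
    let (m , t , tP , t-inj , t-exh) =
          transversal (λ i → ∃[ x ] f x ≡ i) _≡_ sym refl (allFin n)
        index x = t-exh (∈-allFin (f x)) (x , refl)
    in m , mk↔ₛ′ (proj₁ ∘ index) (proj₁ ∘ tP)
         (λ j → t-inj _ _ (trans (proj₂ (index _)) (proj₂ (tP j))))
         (λ x → f-inj (trans (proj₂ (tP _)) (proj₂ (index x))))

  -- The pigeonhole behind compactness: if at every stage of a decreasing
  -- sequence some member of a finite list survives, then one member survives
  -- all stages.
  any-∀ : ∀ {a p} {X : Set a} (P : ℕ → X → Set p) →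
    (∀ {m n} → m ≤ n → ∀ {x} → P n x → P m x) →
    (xs : List X) → (∀ n → Any (P n) xs) → Any (λ x → ∀ n → P n x) xs
  any-∀ P anti []       some = case some 0 of λ ()
  any-∀ P anti (x ∷ xs) some with em {P = ∀ n → P n x}
  ... | yes px = here px
  ... | no ¬px = there (any-∀ P anti xs later)
    where
    failure : ∃[ n ] ¬ P n x
    failure = decidable-stable em λ none → ¬px λ n →
      decidable-stable em λ ¬pn → none (n , ¬pn)

    later : ∀ n → Any (P n) xs
    later n with some (n ⊔ proj₁ failure)
    ... | here p  = ⊥-elim (proj₂ failure (anti (m≤n⊔m n _) p))
    ... | there q = Any.map (anti (m≤m⊔n n _)) q

  -- A minimal expanding subclass

  module MinimalSubclass
    {L : Signature} {R : Symbols} {K : Class L} {K₀ : Class (L ∪ R)}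
    (jep : JointEmbedding K) (inhabitant : Σ (Structure L) K)
    (her₀ : Hereditary K₀) (exp₀ : IsExpansionOf K K₀)
    (finitelyMany : ∀ A → K A → Σ (List (Expansion R A)) λ Es →
      (E : Expansion R A) → K₀ (A ⊕ E) → Any (SameExpansion {A = A} E) Es)
    (e : ℕ → Structure (L ∪ R))
    (enumerates : ∀ {A*} → K₀ A* → ∃[ n ] Isomorphism A* (e n)) where

    open IsExpansionOf exp₀ using (reducts)

    Expands : Class (L ∪ R) → Set₁
    Expands K* = ∀ A → K A → Σ (Expansion R A) λ E → K* (A ⊕ E)

    Omit : Structure (L ∪ R) → Class (L ∪ R) → Class (L ∪ R)
    Omit X K* A* = K* A* × ¬ Embedding X A*

    -- X is omitted if the remaining class still expands K.  That condition
    -- quantifies over structures; branching on its decision, rather than stating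
    -- it, keeps the class a predicate of level zero.
    prune : (K* : Class (L ∪ R)) (X : Structure (L ∪ R)) →
            Dec (Expands (Omit X K*)) → Class (L ∪ R)
    prune K* X (yes _) = Omit X K*
    prune K* X (no _)  = K*

    chain : ℕ → Class (L ∪ R)
    chain zero    = K₀
    chain (suc n) = prune (chain n) (e n) em

    Minimal : Class (L ∪ R)
    Minimal A* = ∀ n → chain n A*

    prune-⊆ : ∀ {K* X} d → prune K* X d ⊆ K*
    prune-⊆ (yes _) = proj₁
    prune-⊆ (no _)  = id

    prune-hereditary : ∀ {K* X} d → Hereditary K* → Hereditary (prune K* X d)
    prune-hereditary (yes _) her (kB , X↛B) f = her kB f , λ x → X↛B (f ∘ₑ x)
    prune-hereditary (no _)  her kB f = her kB f

    prune-expands : ∀ {K* X} d → Expands K* → Expands (prune K* X d)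
    prune-expands (yes exp) _   = exp
    prune-expands (no _)    exp = exp

    chain-antitone : ∀ {m n} → m ≤ n → chain n ⊆ chain m
    chain-antitone {m} {zero}  z≤n kA = kA
    chain-antitone {m} {suc n} m≤1+n kA with m≤n⇒m<n∨m≡n m≤1+n
    ... | inj₁ (s≤s m≤n) = chain-antitone m≤n (prune-⊆ {chain n} {e n} em kA)
    ... | inj₂ refl      = kA

    chain-hereditary : ∀ n → Hereditary (chain n)
    chain-hereditary zero    = her₀
    chain-hereditary (suc n) =
      prune-hereditary {chain n} {e n} em (chain-hereditary n)

    chain-expands : ∀ n → Expands (chain n)
    chain-expands zero    = IsExpansionOf.expansions exp₀
    chain-expands (suc n) =
      prune-expands {chain n} {e n} em (chain-expands n)

    minimal-hereditary : Hereditary Minimal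
    minimal-hereditary kB f n = chain-hereditary n (kB n) f

    minimal-expands : Expands Minimal
    minimal-expands A kA =
      let (Es , listed) = finitelyMany A kA
          (E , _ , kE) = find (any-∀ (λ n E → chain n (A ⊕ E))
            (λ m≤n → chain-antitone m≤n) Es
            λ n → let (E′ , kE′) = chain-expands n A kA in
              Any.map (λ same → chain-hereditary n kE′
                         (embedding (iso-sym (sameExpansion⇒iso same))))
                      (listed E′ (chain-antitone {n = n} z≤n kE′)))
      in E , kE

    -- A* equals some e n up to isomorphism; as A* survives, omitting e n was
    -- impossible, which provides B.
    unavoidable : ∀ {A*} → Minimal A* → Σ (Structure L) λ B → K B ×
      ((E : Expansion R B) → Minimal (B ⊕ E) → Embedding A* (B ⊕ E))
    unavoidable {A*} kA* =
      let (n , i) = enumerates (kA* 0)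
          (B , kB , unav) = blocked n i em (kA* (suc n))
      in B , kB , λ E kE → unav E (kE n) ∘ₑ embedding i
      where
      blocked : ∀ n → Isomorphism A* (e n) →
        (d : Dec (Expands (Omit (e n) (chain n)))) →
        prune (chain n) (e n) d A* → Σ (Structure L) λ B → K B ×
          ((E : Expansion R B) → chain n (B ⊕ E) → Embedding (e n) (B ⊕ E))
      blocked n i (yes _) (_ , e↛A) = ⊥-elim (e↛A (embedding (iso-sym i)))
      blocked n i (no ¬exp) _ = decidable-stable em λ none → ¬exp λ B kB →
        decidable-stable em λ ¬E → none (B , kB , λ E kE →
          decidable-stable em λ e↛B → ¬E (E , kE , e↛B))

    minimal-isoTypes : ∀ A → K A → IsoTypes Minimal A
    minimal-isoTypes A kA =
      let (Es , listed) = finitelyMany A kA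
          (n , t , tK , t-inj , t-exh) = transversal (λ E → Minimal (A ⊕ E))
            (λ E E′ → Isomorphism (A ⊕ E) (A ⊕ E′)) iso-sym iso-refl Es
      in record
        { number     = n
        ; type       = t
        ; inClass    = tK
        ; distinct   = t-inj
        ; exhaustive = λ E kE →
            let (E′ , E′∈ , same) = find (listed E (kE 0))
                i = sameExpansion⇒iso {E = E} {E′} same
                (j , f) = t-exh E′∈
                            (minimal-hereditary kE (embedding (iso-sym i)))
            in j , iso-trans f (iso-sym i)
        }

    -- The inhabitant serves the empty family.
    jointEmbedding-family : (n : ℕ) (B : Fin n → Structure L) → (∀ i → K (B i)) →
      Σ (Structure L) λ C → K C × (∀ i → Embedding (B i) C)
    jointEmbedding-family zero    B kB =
      let (C , kC) = inhabitant in C , kC , λ ()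
    jointEmbedding-family (suc n) B kB =
      let (C , kC , f) = jointEmbedding-family n (B ∘ suc) (kB ∘ suc)
          (D , kD , g , h) = jep (kB zero) kC
      in D , kD , λ { zero → g ; (suc i) → h ∘ₑ f i }

    minimal-expansionProperty : ExpansionProperty K Minimal
    minimal-expansionProperty = record
      { isExpansionOf = record
        { reducts    = λ A* kA → reducts A* (kA 0)
        ; expansions = minimal-expands
        }
      ; universal = λ A kA →
          let open IsoTypes (minimal-isoTypes A kA)
              block i = unavoidable (inClass i)
              (C , kC , f) = jointEmbedding-family number
                (proj₁ ∘ block) (proj₁ ∘ proj₂ ∘ block)
          in C , kC , λ E E′ kE kE′ →
            let (i , g) = exhaustive E kE
                p = pullbackₑ (C ⊕ E′) (f i)
            in p ∘ₑ proj₂ (proj₂ (block i)) _ (minimal-hereditary kE′ p)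
                 ∘ₑ embedding (iso-sym g)
      }

  -- Ages of structures

  -- Finite sets of natural numbers are coded by binary numerals in bijective
  -- base 2, by declaring the digit 2 to mark a member and the digit 1 a
  -- non-member.
  member : ℕᵇ → ℕ → Bool
  member zeroᵇ    _       = false
  member 2[1+ b ] zero    = true
  member 1+[2 b ] zero    = false
  member 2[1+ b ] (suc i) = member b i
  member 1+[2 b ] (suc i) = member b i

  finiteSet : (N : ℕ) (p : ℕ → Bool) → (∀ i → N ≤ i → p i ≡ false) →
              ∃[ b ] ∀ i → member b i ≡ p i
  finiteSet zero    p out = zeroᵇ , λ i → sym (out i z≤n)
  finiteSet (suc N) p out
    with finiteSet N (p ∘ suc) (λ i N≤i → out (suc i) (s≤s N≤i)) | p 0 in eq
  ... | b , e | true  = 2[1+ b ] , λ { zero → sym eq ; (suc i) → e i }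
  ... | b , e | false = 1+[2 b ] , λ { zero → sym eq ; (suc i) → e i }

  bounded : ∀ n (f : Fin n → ℕ) → ∃[ N ] ∀ i → f i < N
  bounded zero    f = 0 , λ ()
  bounded (suc n) f =
    let (N , f<N) = bounded n (f ∘ suc) in
    suc (f zero) ⊔ N , λ { zero    → m≤m⊔n _ N
                         ; (suc i) → <-≤-trans (f<N i) (m≤n⊔m _ N) }

  age-hereditary : {L : Signature} {F : Structure L} → Hereditary (Age F)
  age-hereditary ((n , B↔n) , g) f =
      injection⇒finite (Inverse.to B↔n ∘ to f)
        (λ e → injective f (↔-injective B↔n e))
    , g ∘ₑ f

  -- A member of the age is determined up to isomorphism by the range of an
  -- embedding in F, which is a finite set.  Numbers that do not code a
  -- substructure are sent to F, an irrelevant default.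
  age-countable : {L : Signature} {F : Structure L} → Carrier F ↔ ℕ →
    Σ (ℕ → Structure L) λ e → ∀ {A} → Age F A → ∃[ n ] Isomorphism A (e n)
  age-countable {L} {F} F↔ℕ = (λ n → e n em) , λ {A} → listed {A}
    where
    code : Carrier F → ℕ
    code = Inverse.to F↔ℕ

    Set[_] : ℕ → Pred (Carrier F) 0ℓ
    Set[ n ] x = T (member (fromℕ n) (code x))

    Closed : ℕ → Set
    Closed n = ∀ f {xs} → All.All Set[ n ] xs → Set[ n ] (fun F f xs)

    sub[_] : ∀ n → Closed n → Substructure F
    sub[ n ] c = record
      { universe = Set[ n ] ; irrelevant = T-irrelevant ; closed = c }

    e : ∀ n → Dec (Closed n) → Structure L
    e n (yes c) = F ↾ sub[ n ] c
    e n (no _)  = F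

    listed : ∀ {A} → Age F A → ∃[ n ] Isomorphism A (e n em)
    listed {A} ((m , A↔m) , f) = n , found em
      where
      Hit : ℕ → Set
      Hit i = ∃[ x ] code (to f x) ≡ i

      N : ∃[ N ] ∀ i → code (to f (Inverse.from A↔m i)) < N
      N = bounded m (λ i → code (to f (Inverse.from A↔m i)))

      out : ∀ i → proj₁ N ≤ i → does (em {P = Hit i}) ≡ false
      out i N≤i = dec-false em λ { (x , refl) → <-irrefl refl
        (<-≤-trans (subst (λ y → code (to f y) < proj₁ N)
                     (Inverse.strictlyInverseʳ A↔m x)
                     (proj₂ N (Inverse.to A↔m x))) N≤i) }

      set : ∃[ b ] ∀ i → member b i ≡ does (em {P = Hit i})
      set = finiteSet (proj₁ N) (λ i → does (em {P = Hit i})) out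

      n : ℕ
      n = toℕᵇ (proj₁ set)

      member-n : ∀ i → member (fromℕ n) i ≡ does (em {P = Hit i})
      member-n i = trans (cong (λ b → member b i) (fromℕ-toℕ (proj₁ set)))
                         (proj₂ set i)

      range : Range f ≐ Set[ n ]
      range =
          (λ { (x , refl) →
             subst T (sym (trans (member-n _) (dec-true em (x , refl)))) tt })
        , λ {y} p → let (x , eq) = toWitness {a? = em}
                          (isYes-does em (subst T (member-n (code y)) p)) in
            x , ↔-injective F↔ℕ eq
        where
        isYes-does : ∀ {P : Set} (d : Dec P) → T (does d) → True d
        isYes-does (yes _) _ = tt

      found : ∀ d → Isomorphism A (e n d)
      found (yes c) = proj₁ (range-iso f (inclusion (sub[ n ] c))
        ( (λ p → (_ , proj₁ range p) , refl)
        , λ { ((_ , p) , refl) → proj₂ range p }))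
      found (no ¬c) = ⊥-elim (¬c λ g ps →
        let S = sub (rangeCopy f)
            (x , _ , eq) = closed S g
              (All.map (λ p → proj₁ (range≐universe f) (proj₂ range p)) ps)
        in proj₁ range (x , eq))

  -- The substructure of F generated by a finite list, as a member of the age.
  -- Membership is squashed through the decision to make it irrelevant.
  hull : {L : Signature} {F : Structure L} → LocallyFinite F →
    (xs : List (Carrier F)) → Σ (Structure L) λ A → Σ (Age F A) λ age →
      ∀ {x} → x ∈ xs → Range (proj₂ age) x
  hull {F = F} locallyFinite xs =
      F ↾ S , (finite , inclusion S) ,
      λ x∈ → (_ , fromWitness (generator x∈)) , refl
    where
    S : Substructure F
    S = record
      { universe   = λ x → True (em {P = Generated F xs x})
      ; irrelevant = T-irrelevant
      ; closed     = λ f ps → fromWitness (apply-fun f (All.map toWitness ps))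
      }

    listed : ((x , _) : Carrier (F ↾ S)) → x ∈ proj₁ (locallyFinite xs)
    listed (x , p) = proj₂ (locallyFinite xs) (toWitness p)

    -- The position in the exhausting list injects the hull in a finite set.
    finite : Finite (Carrier (F ↾ S))
    finite = injection⇒finite (Any.index ∘ listed) λ {x} {y} eq → universe-≡ S
      (trans (lookup-index (listed x))
        (trans (cong (lookup (proj₁ (locallyFinite xs))) eq)
               (sym (lookup-index (listed y)))))

  age-jointEmbedding : {L : Signature} {F : Structure L} → LocallyFinite F →
                       JointEmbedding (Age F)
  age-jointEmbedding {F = F} locallyFinite ((m , A↔m) , f) ((n , B↔n) , g) =
      let (C , age , ⊆C) = hull locallyFinite (as ++ bs) in
      C , age
        , proj₁ (factor f (proj₂ age) (λ { (x , refl) → ⊆C (∈-++⁺ˡ (a∈ x)) }))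
        , proj₁ (factor g (proj₂ age) (λ { (x , refl) → ⊆C (∈-++⁺ʳ as (b∈ x)) }))
    where
    as bs : List (Carrier F)
    as = tabulate (to f ∘ Inverse.from A↔m)
    bs = tabulate (to g ∘ Inverse.from B↔n)

    a∈ : ∀ x → to f x ∈ as
    a∈ x = subst (λ y → to f y ∈ as) (Inverse.strictlyInverseʳ A↔m x)
                 (∈-tabulate⁺ _)

    b∈ : ∀ x → to g x ∈ bs
    b∈ x = subst (λ y → to g y ∈ bs) (Inverse.strictlyInverseʳ B↔n x)
                 (∈-tabulate⁺ _)

  -- The hull of n distinct points has at least n elements.
  age-arbitrarilyLarge : {L : Signature} {F : Structure L} → Carrier F ↔ ℕ →
    LocallyFinite F → ∀ n → Σ (Structure L) λ A → Age F A ×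
      ∃[ m ] (n ≤ m × (Carrier A ↔ Fin m))
  age-arbitrarilyLarge {F = F} F↔ℕ locallyFinite n =
    let point i = Inverse.from F↔ℕ (toℕ {n} i)
        (A , ((m , A↔m) , f) , ⊆A) = hull locallyFinite (tabulate point)
        in-A : (i : Fin n) → Range f (point i)
        in-A i = ⊆A (∈-tabulate⁺ i)
    in A , ((m , A↔m) , f) , m
       , injective⇒≤ {f = λ i → Inverse.to A↔m (proj₁ (in-A i))} (λ {i} {j} eq →
           toℕ-injective (↔-injective (↔-sym F↔ℕ)
             (trans (sym (proj₂ (in-A i)))
               (trans (cong (to f) (↔-injective A↔m eq)) (proj₂ (in-A j))))))
       , A↔m

theorem4 :
  (∀ {ℓ} → ExcludedMiddle ℓ) →
  (L : Signature) → CountableSignature L →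
  (R : Symbols) → Countable (Symbol R) →
  (F : Structure L) → IsFraïsséStructure F →
  (F⁺ : Expansion R F) → IsFraïsséStructure (F ⊕ F⁺) → Precompact F F⁺ →
  (∀ A* → Age (F ⊕ F⁺) A* → Rigid A*) →
  RelativeRamseyForStructures (Age F) (Age (F ⊕ F⁺)) →
  Σ (Class (L ∪ R)) λ K* →
    IsFraïsséClass K* × K* ⊆ Age (F ⊕ F⁺) ×
    RamseyProperty K* × ExpansionProperty (Age F) K*
theorem4 em L _ R _ F F-fraïssé F⁺ _ precompact rigid relativeRamsey =
  K* , fraïssé , K*⊆ , embeddingRamsey⇒ramsey K*-ramsey , K*-ep
  where
  open Classical em
  open IsFraïsséStructure F-fraïssé

  -- Members of the age of F are expanded by pulling F⁺ back along an embedding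
  -- in F.
  age-expansion : IsExpansionOf (Age F) (Age (F ⊕ F⁺))
  age-expansion = record
    { reducts    = λ A* (fin , f) → fin , reductₑ f
    ; expansions = λ A (fin , f) →
        pullback (F ⊕ F⁺) f , fin , pullbackₑ (F ⊕ F⁺) f
    }

  jep : JointEmbedding (Age F)
  jep = age-jointEmbedding locallyFinite

  e : ℕ → Structure (L ∪ R)
  e = proj₁ (age-countable {F = F ⊕ F⁺} countablyInfinite)

  enumerates : ∀ {A*} → Age (F ⊕ F⁺) A* → ∃[ n ] Isomorphism A* (e n)
  enumerates = proj₂ (age-countable {F = F ⊕ F⁺} countablyInfinite)

  inhabitant : Σ (Structure L) (Age F)
  inhabitant = let (A , age , _) = hull locallyFinite [] in A , age

  open MinimalSubclass jep inhabitant age-hereditary age-expansion precompact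
         e enumerates

  K* : Class (L ∪ R)
  K* = Minimal

  K*⊆ : K* ⊆ Age (F ⊕ F⁺)
  K*⊆ kA = kA 0

  K*-hereditary : Hereditary K*
  K*-hereditary = minimal-hereditary

  K*-ep : ExpansionProperty (Age F) K*
  K*-ep = minimal-expansionProperty

  K*-jep : JointEmbedding K*
  K*-jep = expansionProperty⇒jointEmbedding K*-hereditary jep K*-ep

  K*-ramsey : EmbeddingRamsey K*
  K*-ramsey = ramsey K*-hereditary jep K*-ep minimal-isoTypes
    (λ k A kA B* kB* → relativeRamsey k A kA B* (K*⊆ kB*))

  fraïssé : IsFraïsséClass K*
  fraïssé = record
    { finite           = λ kA → proj₁ (K*⊆ kA)
    ; countableUpToIso = e , λ kA → enumerates (K*⊆ kA)
    ; arbitrarilyLarge = λ n →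
        let (A , kA , m , n≤m , A↔m) =
              age-arbitrarilyLarge countablyInfinite locallyFinite n
            (E , kE) = IsExpansionOf.expansions
                         (ExpansionProperty.isExpansionOf K*-ep) A kA
        in A ⊕ E , kE , m , n≤m , A↔m
    ; hereditary       = K*-hereditary
    ; jointEmbedding   = K*-jep
    ; amalgamation     = amalgamate K*-jep K*-ramsey (λ A kA → rigid A (K*⊆ kA))
    }
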